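{- There exists a covering system of the integers whose moduli are all odd and greater than $1$, in which exactly three congruences have modulus $9$ and the congruences with moduli different from $9$ have pairwise distinct moduli.
   Context: A covering system is a finite collection of congruences $r_i\pmod{m_i}$ such that every integer satisfies at least one of them. -}

module Defs where

open import Data.Nat as ℕ using (ℕ; _<_)
open import Data.Nat.Divisibility as ℕD using ()
open import Data.Integer as ℤ using (ℤ; +_; _-_)
open import Data.Integer.Divisibility as ℤD using ()
open import Data.Product using (_×_; _,_; proj₂)
open import Data.List using (List; filter; map; length)
open import Data.List.Relation.Unary.Any using (Any)
open import Data.List.Relation.Unary.All using (All)
open import Data.List.Relation.Unary.Unique.Propositional using (Unique)
open import Relation.Nullary using (¬_)
open import Relation.Nullary.Decidable using (¬?)
open import Relation.Binary.PropositionalEquality using (_≡_)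

-- A congruence  r (mod m)  is represented by the pair (r , m).
Congruence : Set
Congruence = ℕ × ℕ

modulus : Congruence → ℕ
modulus (r , m) = m

_satisfies_ : ℤ → Congruence → Set
x satisfies (r , m) = (+ m) ℤD.∣ (x - + r)

IsCovering : List Congruence → Set
IsCovering cs = ∀ (x : ℤ) → Any (x satisfies_) cs

OddModulusGT1 : Congruence → Set
OddModulusGT1 (r , m) = ¬ (2 ℕD.∣ m) × 1 < m × r < m

withModulus9 : List Congruence → List Congruence
withModulus9 = filter (λ c → modulus c ℕ.≟ 9)

withModulusNot9 : List Congruence → List Congruence
withModulusNot9 = filter (λ c → ¬? (modulus c ℕ.≟ 9))

Theorem2p5Property : List Congruence → Set
Theorem2p5Property cs =
  All OddModulusGT1 cs
  × Unique cs
  × IsCovering cs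
  × length (withModulus9 cs) ≡ 3
  × Unique (map modulus (withModulusNot9 cs))

{-# OPTIONS --safe #-}
-- A system consists of congruences (the base) and of further lists of congruences (the units), all with
-- moduli dividing D, such that every integer lies in the base or else in every one of the units.  The
-- moduli of the units (1 allowed) are distinct, also across units.  Let Q be prime to D.  If x lies in
-- all units and in a class c modulo a divisor q of Q, then x lies, for every unit, in the intersection of
-- c with a member of that unit; these intersections have moduli d q, and d q determines d and q, and d
-- determines the unit.  Hence, with n units, each q > 1 dividing Q can be used n times to enlarge the
-- base, and n times to build new units.
--
-- With n units and a prime p, use each pᵏ (k = 1, …, K) on n of the p subclasses of one class modulo
-- pᵏ⁻¹, and split one subclass further.  The p − n − 1 subclasses left over retain the n units and share
-- the n intersections with modulus d pᵏ, which makes n + n / (p − n − 1) units.  The class modulo pᴷ at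
-- the end can use every pᵏ with k ≤ K, that is n (K + 1) units, and is covered by means of a fresh prime
-- s ≤ n (K + 1).  Starting from 9 units, the primes 13, 17, 19, 23 yield 12, 15, 20, 30 units, and 30
-- units suffice to cover everything with the prime 29.
--
-- It remains to find a system with 9 units, three moduli 9 and otherwise distinct moduli in the base.
-- The one below, with D = 3⁶ 5⁴ 7³ 11², was found by local search; its congruences modulo 3 and 9 leave
-- only the class 2 mod 3.

module Submission where

open import Defs
open import Data.Bool using (Bool; true; false; T; not; _∧_; _∨_; if_then_else_)
open import Data.Bool.ListAction using (any; all)
open import Data.Bool.Properties using (T?)
open import Data.Empty using (⊥; ⊥-elim)
open import Data.Integer as ℤ using (ℤ; +_; _-_)
import Data.Integer.DivMod as ℤDM
open import Data.Integer.Divisibility.Signed as ℤS using (∣⇒∣ᵤ; ∣ᵤ⇒∣)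
import Data.Integer.Properties as ℤP
open import Data.Integer.Tactic.RingSolver using (solve-∀)
open import Data.List using (List; []; _∷_; _++_; map; concat; concatMap; filterᵇ; length; upTo; zipWith; cartesianProduct)
open import Data.List.Membership.Propositional using (_∈_; find)
open import Data.List.Membership.Propositional.Properties
  using (∈-upTo⁺; ∈-++⁺ˡ; ∈-++⁺ʳ; ∈-map⁺; ∈-map⁻)
import Data.List.Properties as ListP
open import Data.List.Relation.Binary.Disjoint.Propositional using (Disjoint)
open import Data.List.Relation.Unary.All as All using (All; []; _∷_)
import Data.List.Relation.Unary.All.Properties as AllP
open import Data.List.Relation.Unary.AllPairs as AllPairs using (AllPairs; []; _∷_)
import Data.List.Relation.Unary.AllPairs.Properties as AllPairsP
open import Data.List.Relation.Unary.Any as Any using (Any; here; there)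
import Data.List.Relation.Unary.Any.Properties as AnyP
open import Data.List.Relation.Unary.Unique.DecPropositional using (unique?)
open import Data.List.Relation.Unary.Unique.Propositional using (Unique)
import Data.List.Relation.Unary.Unique.Propositional.Properties as UniqueP
open import Data.Nat as ℕ using (ℕ; zero; suc; _+_; _*_; _<_; _≡ᵇ_; _<ᵇ_; NonZero)
open import Data.Nat.Coprimality as Coprimality using (Coprime; coprime-divisor)
open import Data.Nat.Divisibility as ℕD using (_∣_)
import Data.Nat.DivMod as ℕDM
open import Data.Nat.Primality using (prime[2]; euclidsLemma)
import Data.Nat.Properties as ℕP
open import Data.Product using (_×_; _,_; proj₁; proj₂; ∃-syntax)
open import Data.Product.Properties using (≡-dec)
open import Data.Sum as Sum using (_⊎_; inj₁; inj₂; [_,_]′)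
open import Data.Unit using (tt)
open import Function using (_∘_)
open import Relation.Binary.PropositionalEquality
  using (_≡_; _≢_; refl; sym; trans; cong; cong₂; subst; module ≡-Reasoning)
open import Relation.Nullary using (¬_; Dec)
open import Relation.Nullary.Decidable using (¬?; from-yes; from-no; _×-dec_; True; toWitness)

-- Boolean tests, lists and uniqueness

T-∧⁻ : ∀ {a b} → T (a ∧ b) → T a × T b
T-∧⁻ {true} t = _ , t

T-∨⁻ : ∀ {a b} → T (a ∨ b) → T a ⊎ T b
T-∨⁻ {true}  t = inj₁ _
T-∨⁻ {false} t = inj₂ t

Any-any⁻ : ∀ {A : Set} {P : A → Set} f xs → (∀ x → T (f x) → P x) → T (any f xs) → Any P xs
Any-any⁻ f xs h t = Any.map (h _) (AnyP.any⁻ f xs t)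

All-all⁻ : ∀ {A : Set} {P : A → Set} f xs → (∀ x → T (f x) → P x) → T (all f xs) → All P xs
All-all⁻ f xs h t = All.map (h _) (AllP.all⁺ f xs t)

unfilter : ∀ {A : Set} {P : A → Set} (f : A → Bool) {xs} → Any P (filterᵇ f xs) → Any P xs
unfilter f = AnyP.filter⁻ (λ x → T? (f x))

Any-∩ : ∀ {A : Set} {P R : A → Set} {xs} → All R xs → Any P xs → Any (λ x → R x × P x) xs
Any-∩ (r ∷ rs) (here p)  = here (r , p)
Any-∩ (r ∷ rs) (there p) = there (Any-∩ rs p)

++-unique⁻ : ∀ {A : Set} (xs : List A) {ys} → Unique (xs ++ ys) → Unique xs × Unique ys × Disjoint xs ys
++-unique⁻ []       u       = [] , u , λ ()
++-unique⁻ (x ∷ xs) (x∉ ∷ u) with ++-unique⁻ xs u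
... | uxs , uys , disj = AllP.++⁻ˡ xs x∉ ∷ uxs , uys , λ where
  (here refl , v∈) → All.lookup (AllP.++⁻ʳ xs x∉) v∈ refl
  (there v∈  , w∈) → disj (v∈ , w∈)

-- Remainders and residue classes

-- Total, so that the checks below need no NonZero instances; n mod 0 = n.
_mod_ : ℕ → ℕ → ℕ
n mod zero  = n
n mod suc m = n ℕ.% suc m

_divides_ : ℕ → ℕ → Bool
m divides n = n mod m ≡ᵇ 0

∣-mod : ∀ n m → + m ℤS.∣ + n - + (n mod m)
∣-mod n zero    = ℤS.divides ℤ.0ℤ (trans (ℤP.+-inverseʳ (+ n)) (sym (ℤP.*-zeroˡ (+ 0))))
∣-mod n (suc m) = ℤS.divides (+ q) (trans (cong (λ k → k - + r) eq) (cancel (+ r) _))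
  where
  q = n ℕ./ suc m
  r = n ℕ.% suc m
  eq : + n ≡ + r ℤ.+ + q ℤ.* + suc m
  eq = trans (cong +_ (ℕDM.m≡m%n+[m/n]*n n (suc m)))
             (trans (ℤP.pos-+ r _) (cong (ℤ._+_ (+ r)) (ℤP.pos-* q (suc m))))
  cancel : ∀ a b → (a ℤ.+ b) - a ≡ b
  cancel = solve-∀

divides-sound : ∀ m n → T (m divides n) → + m ℤS.∣ + n
divides-sound m n t = subst (+ m ℤS.∣_) lemma (∣-mod n m)
  where
  lemma : + n - + (n mod m) ≡ + n
  lemma = trans (cong (λ k → + n - + k) (ℕP.≡ᵇ⇒≡ (n mod m) 0 t)) (ℤP.+-identityʳ (+ n))

divides⇒∣ : ∀ m n → T (m divides n) → m ∣ n
divides⇒∣ m n t = ∣⇒∣ᵤ (divides-sound m n t)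

mod-< : ∀ n m → 0 < m → n mod m < m
mod-< n (suc m) _ = ℕDM.m%n<n n (suc m)

telescope : ∀ x r a → (x - r) ℤ.+ (r - a) ≡ x - a
telescope = solve-∀

-- The same relation as _satisfies_, as a record so that x and c can be inferred.
record _⊨_ (x : ℤ) (c : Congruence) : Set where
  constructor lies
  field divisible : + modulus c ℤS.∣ x - + proj₁ c

⊨⇒satisfies : ∀ {x c} → x ⊨ c → x satisfies c
⊨⇒satisfies (lies s) = ∣⇒∣ᵤ s

within : ℕ → ℕ → Congruence → Bool
within r M (a , m) = (m divides M) ∧ (r mod m ≡ᵇ a)

within-sound : ∀ {r M x} c → T (within r M c) → x ⊨ (r , M) → x ⊨ c
within-sound {r} {M} {x} (a , m) t (lies s) with T-∧⁻ {m divides M} t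
... | m∣M , r≡a = lies (subst (+ m ℤS.∣_) (telescope x (+ r) (+ a))
        (ℤS.∣m∣n⇒∣m+n (ℤS.∣-trans (divides-sound m M m∣M) s)
                      (subst (λ k → + m ℤS.∣ + r - + k) (ℕP.≡ᵇ⇒≡ (r mod m) a r≡a) (∣-mod r m))))

-- With x - r = k M, the remainder of k modulo p selects the subclass.
refine : ∀ {r M x} p → .{{NonZero p}} → x ⊨ (r , M) →
         ∃[ j ] j < p × x ⊨ (r + j * M , M * p)
refine {r} {M} {x} p (lies (ℤS.divides k eq)) = k ℤDM.%ℕ p , ℤDM.n%ℕd<d k p ,
    lies (ℤS.divides (k ℤDM./ℕ p) eq′)
  where
  open ≡-Reasoning
  j = k ℤDM.%ℕ p
  q = k ℤDM./ℕ p
  expand : ∀ x r j M q p → x - r ≡ (j ℤ.+ q ℤ.* p) ℤ.* M → x - (r ℤ.+ j ℤ.* M) ≡ q ℤ.* (M ℤ.* p)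
  expand x r j M q p h = trans (regroup x r (j ℤ.* M)) (trans (cong (λ k → k - j ℤ.* M) h) (collect j M q p))
    where
    regroup : ∀ x r b → x - (r ℤ.+ b) ≡ (x - r) - b
    regroup = solve-∀
    collect : ∀ j M q p → (j ℤ.+ q ℤ.* p) ℤ.* M - j ℤ.* M ≡ q ℤ.* (M ℤ.* p)
    collect = solve-∀
  eq′ : x - + (r + j * M) ≡ q ℤ.* + (M * p)
  eq′ = begin
    x - + (r + j * M)            ≡⟨ cong (x -_) (trans (ℤP.pos-+ r (j * M)) (cong (ℤ._+_ (+ r)) (ℤP.pos-* j M))) ⟩
    x - (+ r ℤ.+ + j ℤ.* + M)    ≡⟨ expand x (+ r) (+ j) (+ M) q (+ p) (trans eq (cong (ℤ._* + M) (ℤDM.a≡a%ℕn+[a/ℕn]*n k p))) ⟩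
    q ℤ.* (+ M ℤ.* + p)          ≡⟨ cong (q ℤ.*_) (sym (ℤP.pos-* M p)) ⟩
    q ℤ.* + (M * p)              ∎

-- Deciding coverage by successive splitting

branches : ℕ → (ℕ → Bool) → Bool
-- For p = 0 the conjunction over `upTo p` would hold vacuously although no subclass exists; the
-- first test rules this out.
branches p f = (0 <ᵇ p) ∧ all f (upTo p)

branches-sound : ∀ {r M x p} f {P : Set} → (∀ j → T (f j) → x ⊨ (r + j * M , M * p) → P) →
                 T (branches p f) → x ⊨ (r , M) → P
branches-sound {p = suc p} f step t s with refine (suc p) s
... | j , j<p , s′ = step j (All.lookup (AllP.all⁺ f (upTo (suc p)) t) (∈-upTo⁺ j<p)) s′

Cs Units : Set
Cs    = List Congruence
Units = List Cs

Covered : Cs → Units → ℤ → Set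
Covered L U x = Any (x ⊨_) L ⊎ All (Any (x ⊨_)) U

-- A filter for speed: dropping congruences only makes coverage harder, so its soundness is
-- `unfilter`. It discards the congruences that disagree with r modulo t.
compatible : ℕ → ℕ → Congruence → Bool
compatible t r (a , m) = not (t divides m) ∨ (a mod t ≡ᵇ r mod t)

mentions : ℕ → Cs → Bool
mentions t = any (λ c → t divides modulus c)

leaf : Cs → Units → ℕ → ℕ → Bool
leaf L U r M = any (within r M) L ∨ all (any (within r M)) U

-- The schedule consists of pairs (p , pᵏ): the class r mod M is split into p parts if some congruence
-- still compatible with it has a modulus divisible by pᵏ.
check split : List (ℕ × ℕ) → Cs → Units → ℕ → ℕ → Bool
check s L U r M = leaf L U r M ∨ split s L U r M
split []            L U r M = false
split ((p , t) ∷ s) L U r M =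
  if mentions t L ∨ any (mentions t) U
  then branches p (λ j → check s (filterᵇ (compatible t (r + j * M)) L)
                                    (map (filterᵇ (compatible t (r + j * M))) U)
                                    (r + j * M) (M * p))
  else split s L U r M

leaf-sound : ∀ {r M x} L U → T (leaf L U r M) → x ⊨ (r , M) → Covered L U x
leaf-sound {r} {M} {x} L U t s with T-∨⁻ {any (within r M) L} t
... | inj₁ u = inj₁ (Any-any⁻ (within r M) L inside u)
  where
  inside : ∀ c → T (within r M c) → x ⊨ c
  inside c v = within-sound c v s
... | inj₂ u = inj₂ (All-all⁻ (any (within r M)) U (λ V → Any-any⁻ (within r M) V inside) u)
  where
  inside : ∀ c → T (within r M c) → x ⊨ c
  inside c v = within-sound c v s

check-sound : ∀ s L U {r M x} → T (check s L U r M) → x ⊨ (r , M) → Covered L U x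
split-sound : ∀ s L U {r M x} → T (split s L U r M) → x ⊨ (r , M) → Covered L U x
check-sound s L U {r} {M} t x∈ with T-∨⁻ {leaf L U r M} t
... | inj₁ u = leaf-sound L U u x∈
... | inj₂ u = split-sound s L U u x∈
split-sound ((p , q) ∷ s) L U {r} {M} {x} t x∈ with mentions q L ∨ any (mentions q) U
... | true  = branches-sound (λ j → check s (L′ j) (U′ j) (r + j * M) (M * p)) step t x∈
  where
  L′ : ℕ → Cs
  L′ j = filterᵇ (compatible q (r + j * M)) L
  U′ : ℕ → Units
  U′ j = map (filterᵇ (compatible q (r + j * M))) U
  step : ∀ j → T (check s (L′ j) (U′ j) (r + j * M) (M * p)) → x ⊨ (r + j * M , M * p) → Covered L U x
  step j u x∈′ = Sum.map (unfilter f) (All.map (unfilter f) ∘ AllP.map⁻) (check-sound s (L′ j) (U′ j) u x∈′)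
    where f = compatible q (r + j * M)
... | false = split-sound s L U t x∈

everywhere : ∀ s L U → T (check s L U 0 1) → ∀ x → Covered L U x
everywhere s L U t x = check-sound s L U t (lies (ℤS.divides (x - + 0) (sym (ℤP.*-identityʳ _))))

-- Chinese remaindering for divisors of coprime D and Q

module CRT (D Q α β : ℕ) (bezout : Q * α + D * β ≡ 1 + D * Q) where

  -- `bezout` makes α an inverse of Q modulo D and β one of D modulo Q, written without subtraction.
  -- The same two coefficients serve all divisors d of D and q of Q.
  crt : Congruence → Congruence → Congruence
  crt (u , d) (w , q) = (u * (Q * α) + w * (D * β)) mod (d * q) , d * q

  -- Multiplying `bezout` by x gives x - y = (x - u) Q α + (x - w) D β - x D Q, and each of the
  -- three terms is a multiple of d q.
  crt-sound : ∀ {x} c e → modulus c ∣ D → modulus e ∣ Q →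
              x ⊨ c → x ⊨ e → x ⊨ crt c e
  crt-sound {x} (u , d) (w , q) d∣D q∣Q (lies (ℤS.divides s es)) (lies (ℤS.divides t et))
    with ∣ᵤ⇒∣ {+ d} {+ D} d∣D | ∣ᵤ⇒∣ {+ q} {+ Q} q∣Q
  ... | ℤS.divides D′ eD | ℤS.divides Q′ eQ =
    lies (subst (+ (d * q) ℤS.∣_) (telescope x (+ y) (+ (y mod (d * q))))
      (ℤS.∣m∣n⇒∣m+n (ℤS.divides (s ℤ.* Q′ ℤ.* + α ℤ.+ t ℤ.* D′ ℤ.* + β ℤ.- x ℤ.* D′ ℤ.* Q′) eq) (∣-mod y (d * q))))
    where
    y = u * (Q * α) + w * (D * β)
    y≡ : + y ≡ + u ℤ.* (+ Q ℤ.* + α) ℤ.+ + w ℤ.* (+ D ℤ.* + β)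
    y≡ = trans (ℤP.pos-+ (u * (Q * α)) _) (cong₂ ℤ._+_
           (trans (ℤP.pos-* u _) (cong (ℤ._*_ (+ u)) (ℤP.pos-* Q α)))
           (trans (ℤP.pos-* w _) (cong (ℤ._*_ (+ w)) (ℤP.pos-* D β))))
    bezoutℤ : + Q ℤ.* + α ℤ.+ + D ℤ.* + β ≡ + 1 ℤ.+ + D ℤ.* + Q
    bezoutℤ = trans (sym (cong₂ ℤ._+_ (ℤP.pos-* Q α) (ℤP.pos-* D β)))
                (trans (sym (ℤP.pos-+ (Q * α) (D * β))) (trans (cong +_ bezout)
                  (trans (ℤP.pos-+ 1 (D * Q)) (cong (ℤ._+_ (+ 1)) (ℤP.pos-* D Q)))))
    spread : ∀ x u w A B N → A ℤ.+ B ≡ + 1 ℤ.+ N →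
             x - (u ℤ.* A ℤ.+ w ℤ.* B) ≡ (x - u) ℤ.* A ℤ.+ (x - w) ℤ.* B - x ℤ.* N
    -- `r₁` is an unconditional identity with the correction term x ((1 + N) - (A + B)), which `h`
    -- makes vanish.
    spread x u w A B N h = trans (r₁ x u w A B N) (trans (cong (λ k → (x - u) ℤ.* A ℤ.+ (x - w) ℤ.* B - x ℤ.* N ℤ.+ x ℤ.* ((+ 1 ℤ.+ N) - k)) h) (r₂ x N _))
      where
      r₁ : ∀ x u w A B N → x - (u ℤ.* A ℤ.+ w ℤ.* B) ≡
           (x - u) ℤ.* A ℤ.+ (x - w) ℤ.* B - x ℤ.* N ℤ.+ x ℤ.* ((+ 1 ℤ.+ N) - (A ℤ.+ B))
      r₁ = solve-∀
      r₂ : ∀ x N z → z ℤ.+ x ℤ.* ((+ 1 ℤ.+ N) - (+ 1 ℤ.+ N)) ≡ z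
      r₂ = solve-∀
    gather : ∀ s d Q′ q α t D′ β x →
      (s ℤ.* d) ℤ.* (Q′ ℤ.* q ℤ.* α) ℤ.+ (t ℤ.* q) ℤ.* (D′ ℤ.* d ℤ.* β) - x ℤ.* (D′ ℤ.* d ℤ.* (Q′ ℤ.* q)) ≡
      (s ℤ.* Q′ ℤ.* α ℤ.+ t ℤ.* D′ ℤ.* β - x ℤ.* D′ ℤ.* Q′) ℤ.* (d ℤ.* q)
    gather = solve-∀
    eq : x - + y ≡ (s ℤ.* Q′ ℤ.* + α ℤ.+ t ℤ.* D′ ℤ.* + β - x ℤ.* D′ ℤ.* Q′) ℤ.* + (d * q)
    eq = trans (cong (x -_) y≡) (trans (spread x (+ u) (+ w) (+ Q ℤ.* + α) (+ D ℤ.* + β) (+ D ℤ.* + Q) bezoutℤ)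
           (trans (cong₂ (λ a b → a ℤ.* (+ Q ℤ.* + α) ℤ.+ b ℤ.* (+ D ℤ.* + β) - x ℤ.* (+ D ℤ.* + Q)) es et)
           (trans (cong₂ (λ a b → (s ℤ.* + d) ℤ.* (a ℤ.* + α) ℤ.+ (t ℤ.* + q) ℤ.* (b ℤ.* + β) - x ℤ.* (b ℤ.* a)) eQ eD)
           (trans (gather s (+ d) Q′ (+ q) (+ α) t D′ (+ β) x)
                  (cong (ℤ._*_ (s ℤ.* Q′ ℤ.* + α ℤ.+ t ℤ.* D′ ℤ.* + β - x ℤ.* D′ ℤ.* Q′)) (sym (ℤP.pos-* d q)))))))

  -- A common divisor divides both Q α + D β = D Q + 1 and D Q.
  ⊥-divisors : ∀ {d q} → d ∣ D → q ∣ Q → Coprime d q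
  ⊥-divisors d∣D q∣Q {e} (e∣d , e∣q) = ℕD.∣1⇒≡1 (ℕD.∣m+n∣m⇒∣n
    (subst (e ∣_) (trans bezout (ℕP.+-comm 1 (D * Q)))
      (ℕD.∣m∣n⇒∣m+n (ℕD.∣m⇒∣m*n α e∣Q) (ℕD.∣m⇒∣m*n β e∣D)))
    (ℕD.∣m⇒∣m*n Q e∣D))
    where
    e∣D = ℕD.∣-trans e∣d d∣D
    e∣Q = ℕD.∣-trans e∣q q∣Q

  -- As d divides d′ q′ and is coprime to q′, it divides d′; the other divisibilities are symmetric.
  *-injective-on : ∀ {d q d′ q′} → d ∣ D → q ∣ Q → d′ ∣ D → q′ ∣ Q → d * q ≡ d′ * q′ → d ≡ d′ × q ≡ q′
  *-injective-on {d} {q} {d′} {q′} d∣D q∣Q d′∣D q′∣Q eq =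
    ℕD.∣-antisym (left q d∣D q′∣Q eq) (left q′ d′∣D q∣Q (sym eq)) ,
    ℕD.∣-antisym (right d d′∣D q∣Q eq) (right d′ d∣D q′∣Q (sym eq))
    where
    left : ∀ {d d′ q′} q → d ∣ D → q′ ∣ Q → d * q ≡ d′ * q′ → d ∣ d′
    left {d} {d′} {q′} q d∣D q′∣Q eq = coprime-divisor (⊥-divisors d∣D q′∣Q)
      (subst (d ∣_) (trans eq (ℕP.*-comm d′ q′)) (ℕD.m∣m*n q))
    right : ∀ {q d′ q′} d → d′ ∣ D → q ∣ Q → d * q ≡ d′ * q′ → q ∣ q′
    right {q} {d′} {q′} d d′∣D q∣Q eq = coprime-divisor (Coprimality.sym (⊥-divisors d′∣D q∣Q))
      (subst (q ∣_) eq (ℕD.n∣m*n d))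

-- Units, entries and systems

-- An entry (i , c) stands for the intersections of c with the members of the i-th unit.
Entry : Set
Entry = ℕ × Congruence

-- The resource that an entry uses up: its moduli depend on the unit and on q, but not on the
-- residue.
slot : Entry → ℕ × ℕ
slot (i , c) = i , modulus c

nth : Units → ℕ → Cs
nth []      _       = []
nth (V ∷ U) zero    = V
nth (V ∷ U) (suc i) = nth U i

nth-All : ∀ {P : Cs → Set} U i → All P U → i < length U → P (nth U i)
nth-All (V ∷ U) zero    (p ∷ ps) _             = p
nth-All (V ∷ U) (suc i) (p ∷ ps) (ℕ.s≤s i<n)   = nth-All U i ps i<n

∈-nth : ∀ U i {c} → c ∈ nth U i → modulus c ∈ concatMap (map modulus) U
∈-nth (V ∷ U) zero    c∈ = ∈-++⁺ˡ (∈-map⁺ modulus c∈)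
∈-nth (V ∷ U) (suc i) c∈ = ∈-++⁺ʳ (map modulus V) (∈-nth U i c∈)

nth-unique : ∀ U i → Unique (concatMap (map modulus) U) → Unique (map modulus (nth U i))
nth-unique []      i       u = []
nth-unique (V ∷ U) zero    u = proj₁ (++-unique⁻ (map modulus V) u)
nth-unique (V ∷ U) (suc i) u = nth-unique U i (proj₁ (proj₂ (++-unique⁻ (map modulus V) u)))

-- This is how d determines its unit: a modulus found both in the head and in the tail contradicts
-- the disjointness from `++-unique⁻`.
nth-disjoint : ∀ U i j {c e} → Unique (concatMap (map modulus) U) → c ∈ nth U i → e ∈ nth U j →
               modulus c ≡ modulus e → i ≡ j
nth-disjoint (V ∷ U) zero    zero    u c∈ e∈ eq = refl
nth-disjoint (V ∷ U) zero    (suc j) u c∈ e∈ eq =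
  ⊥-elim (proj₂ (proj₂ (++-unique⁻ (map modulus V) u)) (∈-map⁺ modulus c∈ , subst (_∈ _) (sym eq) (∈-nth U j e∈)))
nth-disjoint (V ∷ U) (suc i) zero    u c∈ e∈ eq =
  ⊥-elim (proj₂ (proj₂ (++-unique⁻ (map modulus V) u)) (∈-map⁺ modulus e∈ , subst (_∈ _) eq (∈-nth U i c∈)))
nth-disjoint (V ∷ U) (suc i) (suc j) u c∈ e∈ eq =
  cong suc (nth-disjoint U i j (proj₁ (proj₂ (++-unique⁻ (map modulus V) u))) c∈ e∈ eq)

-- `9∣D` ensures that later moduli, which do not divide D, differ from 9. `2∤D` gives odd moduli and
-- also D ≠ 0.
record System : Set where
  field
    D            : ℕ
    base         : Cs
    units        : Units
    covered      : ∀ x → Covered base units x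
    base∣D       : All (λ c → modulus c ∣ D) base
    units∣D      : All (All (λ c → modulus c ∣ D)) units
    units-unique : Unique (concatMap (map modulus) units)
    2∤D          : ¬ (2 ∣ D)
    9∣D          : 9 ∣ D
    admissible   : All OddModulusGT1 base
    unique       : Unique base
    unique-not9  : Unique (map modulus (withModulusNot9 base))
    nines        : length (withModulus9 base) ≡ 3

-- Extension of a system by a factor Q coprime to D

module Extension (S : System) (Q α β : ℕ) (bezout : Q * α + System.D S * β ≡ 1 + System.D S * Q)
                 (2∤Q : ¬ (2 ∣ Q)) where
  open System S
  open CRT D Q α β bezout

  valid strict : Entry → Bool
  valid  (i , (_ , q)) = (i <ᵇ length units) ∧ (q divides Q)
  strict (i , (_ , q)) = 1 <ᵇ q

  Valid Strict : Entry → Set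
  Valid  (i , (_ , q)) = i < length units × q ∣ Q
  Strict (i , (_ , q)) = 1 < q

  valid-sound : ∀ e → T (valid e) → Valid e
  valid-sound (i , (_ , q)) t with T-∧⁻ {i <ᵇ length units} t
  ... | i<n , q∣Q = ℕP.<ᵇ⇒< i _ i<n , divides⇒∣ q Q q∣Q

  expand : Entry → Cs
  expand (i , c) = map (λ u → crt u c) (nth units i)

  product : List Entry → Cs
  product = concatMap expand

  product-All : ∀ {P : Congruence → Set} {R : Entry → Set} →
                (∀ u e → R e → modulus u ∣ D → P (crt u (proj₂ e))) →
                ∀ {E} → All Valid E → All R E → All P (product E)
  product-All h []                      []       = []
  product-All h {(i , c) ∷ E} (v ∷ vs) (r ∷ rs) =
    AllP.++⁺ (AllP.map⁺ (All.map (λ {u} → h u (i , c) r) (nth-All units i units∣D (proj₁ v)))) (product-All h vs rs)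

  -- The entry whose class contains x names a unit; x also lies in a member of that unit, hence in
  -- their intersection.
  product-covers : ∀ {x E} → All Valid E → All (Any (x ⊨_)) units → Any (x ⊨_) (map proj₂ E) → Any (x ⊨_) (product E)
  product-covers {x} {(i , c) ∷ E} ((i<n , q∣Q) ∷ vs) us (here s) =
    AnyP.++⁺ˡ (AnyP.map⁺ (Any.map (λ {u} (d∣D , s′) → crt-sound {x} u c d∣D q∣Q s′ s)
      (Any-∩ (nth-All units i units∣D i<n) (nth-All units i us i<n))))
  product-covers {x} {(i , c) ∷ E} (v ∷ vs) us (there s) = AnyP.++⁺ʳ (expand (i , c)) (product-covers vs us s)

  product-unique : ∀ E → All Valid E → Unique (map slot E) → Unique (map modulus (product E))
  product-unique []            _                  _        = []
  product-unique ((i , c) ∷ E) ((i<n , q∣Q) ∷ vs) (s∉ ∷ s) =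
    subst Unique (sym (ListP.map-++ modulus (expand (i , c)) (product E)))
      (UniqueP.++⁺ (AllPairsP.map⁺ (AllPairsP.map⁺ (within-unit (nth-All units i units∣D i<n)
                     (AllPairsP.map⁻ (nth-unique units i units-unique)))))
                   (product-unique E vs s) λ (m∈ , m∈′) → clash (∈-map⁻ modulus m∈) (∈-map⁻ modulus m∈′))
    where
    within-unit : ∀ {V} → All (λ u → modulus u ∣ D) V → AllPairs (λ u v → modulus u ≢ modulus v) V →
                  AllPairs (λ u v → modulus (crt u c) ≢ modulus (crt v c)) V
    within-unit []       []       = []
    within-unit (d ∷ ds) (n ∷ ns) =
      All.zipWith (λ (d′ , ≢) eq → ≢ (proj₁ (*-injective-on d q∣Q d′ q∣Q eq))) (ds , n) ∷ within-unit ds ns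
    -- Equality of d q and d′ q′ forces d = d′ and q = q′, and d determines the unit, so the two
    -- entries share a slot, against `s∉`.
    clash : ∀ {m} → (∃[ a ] a ∈ expand (i , c) × m ≡ modulus a) → (∃[ b ] b ∈ product E × m ≡ modulus b) → ⊥
    clash (_ , a∈ , refl) (_ , b∈ , eq)
      with ∈-map⁻ (λ u → crt u c) a∈ | find (AnyP.concatMap⁻ expand {xs = E} b∈)
    ... | u , u∈ , refl | (j , e) , e∈ , b∈e with ∈-map⁻ (λ v → crt v e) b∈e
    ... | v , v∈ , refl with All.lookup vs e∈
    ... | j<n , q′∣Q with *-injective-on (All.lookup (nth-All units i units∣D i<n) u∈) q∣Q
                                         (All.lookup (nth-All units j units∣D j<n) v∈) q′∣Q eq
    ... | d≡ , q≡ = All.lookup (AllP.map⁻ s∉) e∈ (cong₂ _,_ (nth-disjoint units i j units-unique u∈ v∈ d≡) q≡)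

  -- `exhaustive` concerns only classes modulo divisors of Q; the old units come in through
  -- `product`. `kills-strict` keeps the moduli of `added` away from those of `base`, whereas in
  -- `news` the value q = 1 serves to carry over an old unit whole.
  module _ (schedule : List (ℕ × ℕ)) (kills : List Entry) (news : List (List Entry))
           (exhaustive   : T (check schedule (map proj₂ kills) (map (map proj₂) news) 0 1))
           (kills-valid  : T (all valid kills)) (kills-strict : T (all strict kills))
           (news-valid   : T (all (all valid) news))
           (kills-unique : Unique (map slot kills)) (news-unique : Unique (map slot (concat news))) where

    kv : All Valid kills
    kv = All-all⁻ valid kills valid-sound kills-valid

    ks : All Strict kills
    ks = All-all⁻ strict kills (λ (i , (_ , q)) → ℕP.<ᵇ⇒< 1 q) kills-strict

    nv : All (All Valid) news
    nv = All-all⁻ (all valid) news (λ E → All-all⁻ valid E valid-sound) news-valid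

    added : Cs
    added = product kills

    -- If d q divides D, then q divides both D and Q, so q is coprime to itself and equals 1.
    added∤D : All (λ c → ¬ (modulus c ∣ D)) added
    added∤D = product-All {R = λ e → Valid e × Strict e}
      (λ (_ , d) (i , (_ , q)) ((_ , q∣Q) , 1<q) d∣D dq∣D →
        ℕP.<⇒≢ 1<q (sym (⊥-divisors (ℕD.∣-trans (ℕD.n∣m*n d) dq∣D) q∣Q (ℕD.∣-refl , ℕD.∣-refl))))
      kv (All.zip (kv , ks))

    added-admissible : All OddModulusGT1 added
    added-admissible = product-All {R = λ e → Valid e × Strict e}
      (λ (_ , d) (i , (_ , q)) ((_ , q∣Q) , 1<q) d∣D → admit d q d∣D q∣Q 1<q) kv (All.zip (kv , ks))
      where
      admit : ∀ d q {y} → d ∣ D → q ∣ Q → 1 < q → OddModulusGT1 (y mod (d * q) , d * q)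
      admit d q d∣D q∣Q 1<q = odd , 1<dq , mod-< _ (d * q) (ℕP.<-trans (ℕ.s≤s ℕ.z≤n) 1<dq)
        where
        odd : ¬ (2 ∣ d * q)
        odd 2∣dq with euclidsLemma d q prime[2] 2∣dq
        ... | inj₁ 2∣d = 2∤D (ℕD.∣-trans 2∣d d∣D)
        ... | inj₂ 2∣q = 2∤Q (ℕD.∣-trans 2∣q q∣Q)
        0<d : 0 < d
        -- d = 0 would force D = 0, which is even.
        0<d = ℕP.n≢0⇒n>0 λ { refl → 2∤D (subst (2 ∣_) (sym (ℕD.0∣⇒≡0 d∣D)) (2 ℕD.∣0)) }
        1<dq : 1 < d * q
        1<dq = ℕP.<-≤-trans 1<q (ℕP.m≤n*m q d {{ℕ.>-nonZero 0<d}})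

    added-≢9 : All (λ c → modulus c ≢ 9) added
    added-≢9 = All.map (λ ∤D eq → ∤D (subst (_∣ D) (sym eq) 9∣D)) added∤D

    added-unique : Unique (map modulus added)
    added-unique = product-unique kills kv kills-unique

    *-∣ : ∀ u e → Valid e → modulus u ∣ D → modulus (crt u (proj₂ e)) ∣ D * Q
    *-∣ u e (_ , q∣Q) d∣D = ℕD.*-pres-∣ d∣D q∣Q

    is9? : ∀ c → Dec (modulus c ≡ 9)
    is9? c = modulus c ℕ.≟ 9

    not9? : ∀ c → Dec (modulus c ≢ 9)
    not9? c = ¬? (is9? c)

    extend : System
    extend = record
      { D            = D * Q
      ; base         = base ++ added
      ; units        = map product news
      ; covered      = covered′
      ; base∣D       = AllP.++⁺ (All.map (ℕD.∣m⇒∣m*n Q) base∣D) (product-All *-∣ kv kv)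
      ; units∣D      = AllP.map⁺ (All.map (λ v → product-All *-∣ v v) nv)
      ; units-unique = subst Unique (sym (regroup news)) (product-unique (concat news) (AllP.concat⁺ nv) news-unique)
      ; 2∤D          = λ 2∣DQ → [ 2∤D , 2∤Q ]′ (euclidsLemma D Q prime[2] 2∣DQ)
      ; 9∣D          = ℕD.∣m⇒∣m*n Q 9∣D
      ; admissible   = AllP.++⁺ admissible added-admissible
      -- Here and in `unique-not9`, divisibility separates old moduli from added ones: the former
      -- divide D, the latter do not.
      ; unique       = UniqueP.++⁺ unique (AllPairs.map (λ ≢ eq → ≢ (cong modulus eq)) (AllPairsP.map⁻ added-unique))
                         (λ (c∈ , c∈′) → All.lookup added∤D c∈′ (All.lookup base∣D c∈))
      ; unique-not9  = subst (Unique ∘ map modulus)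
          (sym (trans (ListP.filter-++ not9? base added)
                      (cong (withModulusNot9 base ++_) (ListP.filter-all not9? added-≢9))))
          (subst Unique (sym (ListP.map-++ modulus (withModulusNot9 base) added))
            (UniqueP.++⁺ unique-not9 added-unique λ (m∈ , m∈′) →
              All.lookup (AllP.map⁺ added∤D) m∈′ (All.lookup (AllP.map⁺ (AllP.filter⁺ not9? base∣D)) m∈)))
      ; nines        = trans (cong length (trans (ListP.filter-++ is9? base added)
          (trans (cong (withModulus9 base ++_) (ListP.filter-none is9? added-≢9)) (ListP.++-identityʳ _)))) nines
      }
      where
      covered′ : ∀ x → Covered (base ++ added) (map product news) x
      -- If x is in all old units, its class modulo Q decides: a class of `kills` puts x into
      -- `added`, and otherwise x is in every new unit.
      covered′ x with covered x | everywhere schedule (map proj₂ kills) (map (map proj₂) news) exhaustive x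
      ... | inj₁ b  | _       = inj₁ (AnyP.++⁺ˡ b)
      ... | inj₂ us | inj₁ k  = inj₁ (AnyP.++⁺ʳ base (product-covers kv us k))
      ... | inj₂ us | inj₂ ns = inj₂ (AllP.map⁺ (All.zipWith (λ (v , n) → product-covers v us n) (nv , AllP.map⁻ ns)))
      regroup : ∀ F → concatMap (map modulus) (map product F) ≡ map modulus (product (concat F))
      regroup []      = refl
      regroup (E ∷ F) = trans (cong (map modulus (product E) ++_) (regroup F))
        (trans (sym (ListP.map-++ modulus (product E) (product (concat F))))
               (cong (map modulus) (sym (ListP.concatMap-++ expand E (concat F)))))

-- Chains of powers of a prime

-- The residue pᴷ b is 0 modulo pᵏ and runs, with b, through all residues modulo s.
chainKills : ℕ → ℕ → ℕ → ℕ → List Entry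
chainKills p n K s =
  concatMap (λ k → map (λ h → h , (suc h * p ℕ.^ k , p ℕ.^ suc k)) (upTo n)) (upTo K) ++
  zipWith (λ b (h , k) → h , ((p ℕ.^ K * b) mod (p ℕ.^ k * s) , p ℕ.^ k * s))
          (upTo s) (cartesianProduct (upTo n) (upTo (suc K)))

-- Inside 0 modulo pᵏ, the subclasses 1, ..., n go to `chainKills`, 0 is split further, and n + 1 +
-- j with j < p - n - 1 are left over. The first n lists keep the old units. On the j-th left-over
-- subclass, the extra unit e takes the old unit j a + e; for a = n / (p - n - 1) these indices
-- exhaust the n units without repetition.
chainUnits : ℕ → ℕ → ℕ → ℕ → List (List Entry)
chainUnits p n K a =
  map (λ h → (h , (0 , 1)) ∷ []) (upTo n) ++
  map (λ e → concatMap (λ k → map (λ j → j * a + e , ((suc n + j) * p ℕ.^ k , p ℕ.^ suc k))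
                                  (upTo (p ℕ.∸ suc n)))
                       (upTo K))
      (upTo a)

chainSchedule : ℕ → ℕ → ℕ → List (ℕ × ℕ)
chainSchedule p K s = map (λ k → p , p ℕ.^ suc k) (upTo K) ++ (s , s) ∷ []

unique-slots : ∀ E → {True (unique? (≡-dec ℕ._≟_ ℕ._≟_) (map slot E))} → Unique (map slot E)
unique-slots E {t} = toWitness t

-- Reading off the covering system

-- Stated for an arbitrary system, since comparing types that mention the base of system₅ would make Agda
-- compute it.
conclude : (S : System) → System.units S ≡ [] ∷ [] → ∃[ cs ] Theorem2p5Property cs
conclude S eq = base , admissible , unique , covers , nines , unique-not9
  where
  open System S
  unsatisfiable : ∀ {x U} → U ≡ [] ∷ [] → ¬ All (Any (x ⊨_)) U
  unsatisfiable refl (() ∷ _)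
  covers : IsCovering base
  covers x = [ Any.map ⊨⇒satisfies , (λ us → ⊥-elim (unsatisfiable eq us)) ]′ (covered x)

-- The starting system with nine units

base₀ : Cs
base₀ =
  (0 , 3) ∷ (0 , 5) ∷ (0 , 7) ∷ (1 , 9) ∷ (4 , 9) ∷ (7 , 9) ∷ (0 , 11) ∷ (11 , 15) ∷ (20 , 21) ∷ (22 , 25) ∷
  (2 , 27) ∷ (32 , 33) ∷ (8 , 35) ∷ (44 , 45) ∷ (16 , 49) ∷ (29 , 55) ∷ (59 , 63) ∷ (32 , 75) ∷ (4 , 77) ∷
  (11 , 81) ∷ (14 , 99) ∷ (68 , 105) ∷ (112 , 121) ∷ (27 , 125) ∷ (74 , 135) ∷ (44 , 147) ∷ (59 , 165) ∷
  (162 , 175) ∷ (101 , 189) ∷ (17 , 225) ∷ (137 , 231) ∷ (38 , 243) ∷ (128 , 245) ∷ (227 , 275) ∷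
  (248 , 297) ∷ (143 , 315) ∷ (51 , 343) ∷ (266 , 363) ∷ (77 , 375) ∷ (159 , 385) ∷ (389 , 405) ∷
  (401 , 441) ∷ (239 , 495) ∷ (362 , 525) ∷ (247 , 539) ∷ (227 , 567) ∷ (189 , 605) ∷ (252 , 625) ∷
  (317 , 675) ∷ (617 , 693) ∷ (119 , 729) ∷ (23 , 735) ∷ (437 , 825) ∷ (2 , 847) ∷ (302 , 875) ∷
  (848 , 891) ∷ (368 , 945) ∷ (443 , 1029) ∷ (167 , 1089) ∷ (602 , 1125) ∷ (89 , 1155) ∷ (929 , 1215) ∷
  (562 , 1225) ∷ (695 , 1323) ∷ (602 , 1375) ∷ (644 , 1485) ∷ (962 , 1575) ∷ (884 , 1617) ∷ (1172 , 1701) ∷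
  (933 , 1715) ∷ (464 , 1815) ∷ (752 , 1875) ∷ (1712 , 1925) ∷ (1442 , 2025) ∷ (446 , 2079) ∷ (548 , 2205) ∷
  (2417 , 2475) ∷ (1850 , 2541) ∷ (677 , 2625) ∷ (2063 , 2673) ∷ (2648 , 2695) ∷ (2153 , 2835) ∷
  (2752 , 3025) ∷ (2942 , 3087) ∷ (1652 , 3267) ∷ (2477 , 3375) ∷ (3074 , 3465) ∷ (2549 , 3645) ∷
  (3362 , 3675) ∷ (2256 , 3773) ∷ (2900 , 3969) ∷ (977 , 4125) ∷ (2059 , 4235) ∷ (3127 , 4375) ∷
  (1532 , 4455) ∷ (4337 , 4725) ∷ (149 , 4851) ∷ (4007 , 5103) ∷ (1178 , 5145) ∷ (5414 , 5445) ∷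
  (377 , 5625) ∷ (3812 , 5775) ∷ (3236 , 5929) ∷ (4817 , 6075) ∷ (177 , 6125) ∷ (3287 , 6237) ∷
  (3908 , 6615) ∷ (3502 , 6875) ∷ (7277 , 7425) ∷ (7295 , 7623) ∷ (4427 , 7875) ∷ (1334 , 8019) ∷
  (7058 , 8085) ∷ (5303 , 8505) ∷ (5637 , 8575) ∷ (827 , 9075) ∷ (6176 , 9261) ∷ (9102 , 9625) ∷
  (1982 , 9801) ∷ (227 , 10125) ∷ (9059 , 10395) ∷ (2312 , 11025) ∷ (3089 , 11319) ∷ (5546 , 11907) ∷
  (3227 , 12375) ∷ (3467 , 12705) ∷ (1877 , 13125) ∷ (2549 , 13365) ∷ (11062 , 13475) ∷ (11162 , 14175) ∷
  (2228 , 14553) ∷ (1102 , 15125) ∷ (14408 , 15435) ∷ (15809 , 16335) ∷ (7877 , 16875) ∷ (4337 , 17325) ∷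
  (11321 , 17787) ∷ (14942 , 18225) ∷ (1052 , 18375) ∷ (13808 , 18711) ∷ (8724 , 18865) ∷ (7877 , 19845) ∷
  (13502 , 20625) ∷ (13412 , 22275) ∷ (3830 , 22869) ∷ (12227 , 23625) ∷ (11489 , 24255) ∷ (5708 , 25515) ∷
  (19112 , 25725) ∷ (1652 , 27225) ∷ (21611 , 27783) ∷ (11852 , 28875) ∷ (22475 , 29403) ∷ (10243 , 29645) ∷
  (3602 , 30375) ∷ (21877 , 30625) ∷ (24203 , 31185) ∷ (8612 , 33075) ∷ (31901 , 33957) ∷ (25391 , 35721) ∷
  (12227 , 37125) ∷ (1454 , 38115) ∷ (37502 , 39375) ∷ (23204 , 40095) ∷ (26987 , 40425) ∷ (30186 , 41503) ∷
  (12512 , 42525) ∷ (15927 , 42875) ∷ (27281 , 43659) ∷ (27227 , 45375) ∷ (37928 , 46305) ∷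
  (43859 , 49005) ∷ (2252 , 50625) ∷ (33917 , 51975) ∷ (8087 , 53361) ∷ (8927 , 55125) ∷ (22493 , 56595) ∷
  (25958 , 59535) ∷ (43502 , 61875) ∷ (1577 , 66825) ∷ (5427 , 67375) ∷ (28802 , 70875) ∷ (41729 , 72765) ∷
  (45377 , 75625) ∷ (66887 , 77175) ∷ (38777 , 81675) ∷ (12350 , 83349) ∷ (20102 , 86625) ∷
  (78608 , 88209) ∷ (8549 , 88935) ∷ (44102 , 91125) ∷ (39377 , 91875) ∷ (76178 , 93555) ∷ (66887 , 94325) ∷
  (1262 , 99225) ∷ (84977 , 105875) ∷ (36677 , 111375) ∷ (43034 , 114345) ∷ (48752 , 118125) ∷
  (63737 , 121275) ∷ (42044 , 124509) ∷ (123077 , 127575) ∷ (3677 , 128625) ∷ (33896 , 130977) ∷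
  (6602 , 136125) ∷ (53363 , 138915) ∷ (101252 , 144375) ∷ (30494 , 147015) ∷ (137252 , 151875) ∷
  (31637 , 155925) ∷ (59369 , 160083) ∷ (96602 , 165375) ∷ (147002 , 169785) ∷ (156368 , 178605) ∷
  (71627 , 185625) ∷ (116492 , 190575) ∷ (142760 , 205821) ∷ (159007 , 207515) ∷ (195977 , 212625) ∷
  (153127 , 214375) ∷ (23312 , 218295) ∷ (24752 , 226875) ∷ (213887 , 231525) ∷ (151265 , 250047) ∷
  (138227 , 259875) ∷ (121739 , 266805) ∷ (262502 , 275625) ∷ (244577 , 280665) ∷ (188162 , 282975) ∷
  (287912 , 297675) ∷ (93227 , 317625) ∷ (161552 , 334125) ∷ (248502 , 336875) ∷ (22502 , 354375) ∷
  (22640 , 373527) ∷ (205802 , 385875) ∷ (212501 , 392931) ∷ (229352 , 408375) ∷ (238583 , 416745) ∷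
  (172877 , 433125) ∷ (391349 , 441045) ∷ (262187 , 444675) ∷ (390377 , 455625) ∷ (254802 , 471625) ∷
  (134444 , 480249) ∷ (140177 , 496125) ∷ (450002 , 556875) ∷ (203117 , 571725) ∷ (224177 , 606375) ∷
  (327197 , 617463) ∷ (595058 , 622545) ∷ (560477 , 637875) ∷ (183752 , 643125) ∷ (66002 , 680625) ∷
  (136712 , 694575) ∷ (138602 , 741125) ∷ (745439 , 800415) ∷ (493502 , 826875) ∷ (656462 , 893025) ∷
  (643421 , 916839) ∷ (130352 , 952875) ∷ (633377 , 1002375) ∷ (183752 , 1010625) ∷ (304537 , 1037575) ∷
  (258752 , 1063125) ∷ (232787 , 1091475) ∷ (352802 , 1157625) ∷ (794243 , 1250235) ∷ (170942 , 1334025) ∷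
  (521852 , 1414875) ∷ (797645 , 1440747) ∷ (526052 , 1488375) ∷ (449528 , 1867635) ∷ (1286252 , 1929375) ∷
  (1988912 , 2083725) ∷ (1830677 , 2223375) ∷ (441002 , 2358125) ∷ (1968122 , 2401245) ∷
  (1638002 , 2480625) ∷ (2135102 , 2858625) ∷ (296627 , 3031875) ∷ (1032869 , 3087315) ∷
  (2474012 , 3112725) ∷ (2364752 , 3189375) ∷ (1234802 , 3274425) ∷ (3053927 , 3472875) ∷
  (1957727 , 3675375) ∷ (1715627 , 3898125) ∷ (591824 , 4322241) ∷ (2085302 , 4465125) ∷ (59978 , 4584195) ∷
  (350352 , 5187875) ∷ (2205002 , 5788125) ∷ (1294337 , 6251175) ∷ (5538227 , 6670125) ∷
  (4483502 , 7074375) ∷ (4764377 , 7441875) ∷ (5394314 , 10085229) ∷ (738677 , 10418625) ∷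
  (8953562 , 12006225) ∷ (40427 , 15563625) ∷ (275627 , 17364375) ∷ (16019852 , 20010375) ∷
  (19115714 , 21611205) ∷ (6465377 , 22325625) ∷ (22435877 , 28014525) ∷ (25048802 , 31255875) ∷
  (46580627 , 52093125) ∷ (15880412 , 68762925) ∷ (37174502 , 77182875) ∷ (60616712 , 108056025) ∷
  (23064302 , 114604875) ∷ (81309377 , 156279375) ∷ (78630302 , 343814625) ∷ (228828602 , 540280125) ∷ []

-- `U₀` is all of ℤ and `U₁` the class left by the moduli 3 and 9, so these two units come for free.
-- A modulus of a unit may recur in the base, since it enters the base only multiplied by some q >
-- 1.
U₀ : Cs
U₀ =
  (0 , 1) ∷ []

U₁ : Cs
U₁ =
  (2 , 3) ∷ []

U₂ : Cs
U₂ =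
  (11 , 21) ∷ (17 , 75) ∷ (86 , 147) ∷ (119 , 243) ∷ (2 , 375) ∷ (284 , 495) ∷ (23 , 539) ∷ (134 , 847) ∷
  (716 , 1617) ∷ (299 , 1815) ∷ (761 , 2541) ∷ (860 , 3267) ∷ (3334 , 3773) ∷ (3383 , 15435) ∷
  (12839 , 16335) ∷ (12476 , 17787) ∷ (21884 , 24255) ∷ (4412 , 25725) ∷ (27050 , 33957) ∷ (14477 , 37125) ∷
  (44543 , 46305) ∷ (22640 , 53361) ∷ (67289 , 114345) ∷ (6470 , 124509) ∷ (13673 , 138915) ∷
  (54833 , 169785) ∷ (40427 , 385875) ∷ (443 , 654885) ∷ (374852 , 694575) ∷ (683552 , 1157625) ∷
  (2227052 , 38201625) ∷ []

U₃ : Cs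
U₃ =
  (18 , 35) ∷ (14 , 45) ∷ (167 , 225) ∷ (262 , 275) ∷ (233 , 735) ∷ (287 , 825) ∷ (362 , 1215) ∷
  (1668 , 1715) ∷ (1127 , 1875) ∷ (2552 , 2625) ∷ (1334 , 3645) ∷ (2102 , 4125) ∷ (627 , 4375) ∷
  (662 , 5775) ∷ (5427 , 6125) ∷ (4412 , 8575) ∷ (6162 , 13475) ∷ (19637 , 33075) ∷ (34337 , 40425) ∷
  (60377 , 61875) ∷ (4127 , 75625) ∷ (26252 , 91875) ∷ (23312 , 99225) ∷ (71087 , 121275) ∷
  (40427 , 128625) ∷ (69752 , 144375) ∷ (154487 , 155925) ∷ (148502 , 226875) ∷ (30662 , 363825) ∷
  (91877 , 643125) ∷ (7877 , 1010625) ∷ (5494127 , 7074375) ∷ []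

U₄ : Cs
U₄ =
  (2 , 15) ∷ (9 , 55) ∷ (53 , 105) ∷ (89 , 165) ∷ (233 , 245) ∷ (35 , 363) ∷ (299 , 605) ∷ (1040 , 2079) ∷
  (2664 , 4235) ∷ (3173 , 4851) ∷ (3383 , 5145) ∷ (1949 , 5445) ∷ (5714 , 8085) ∷ (8465 , 14553) ∷
  (10364 , 22869) ∷ (21254 , 88935) ∷ (150779 , 441045) ∷ []

U₅ : Cs
U₅ =
  (9 , 11) ∷ (23 , 33) ∷ (37 , 49) ∷ (39 , 77) ∷ (5 , 99) ∷ (13 , 121) ∷ (200 , 231) ∷ (228 , 385) ∷
  (392 , 675) ∷ (605 , 729) ∷ (641 , 891) ∷ (662 , 1089) ∷ (377 , 1125) ∷ (788 , 1155) ∷ (92 , 1925) ∷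
  (392 , 2475) ∷ (2642 , 3025) ∷ (1127 , 3375) ∷ (2258 , 3465) ∷ (4799 , 6237) ∷ (3627 , 6875) ∷
  (3317 , 7425) ∷ (1817 , 9075) ∷ (6927 , 9625) ∷ (2 , 15125) ∷ (12377 , 16875) ∷ (14117 , 17325) ∷
  (8528 , 18865) ∷ (4877 , 20625) ∷ (19692 , 21175) ∷ (17492 , 27225) ∷ (13673 , 27783) ∷ (8384 , 38115) ∷
  (6470 , 41503) ∷ (40427 , 42875) ∷ (24752 , 45375) ∷ (51242 , 51975) ∷ (3383 , 56595) ∷ (41417 , 63525) ∷
  (59978 , 83349) ∷ (7802 , 86625) ∷ (12987 , 94325) ∷ (183002 , 185625) ∷ (66838 , 207515) ∷
  (81587 , 231525) ∷ (133037 , 282975) ∷ (297992 , 444675) ∷ (88002 , 529375) ∷ (750437 , 848925) ∷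
  (829127 , 1588125) ∷ (51541877 , 52093125) ∷ []

U₆ : Cs
U₆ =
  (4 , 7) ∷ (23 , 63) ∷ (194 , 315) ∷ (296 , 343) ∷ (317 , 405) ∷ (233 , 441) ∷ (92 , 525) ∷ (502 , 625) ∷
  (680 , 693) ∷ (1517 , 1575) ∷ (119 , 2673) ∷ (5216 , 7623) ∷ (2102 , 12375) ∷ (9374 , 12705) ∷
  (2252 , 13125) ∷ (2792 , 18225) ∷ (11552 , 18375) ∷ (19343 , 19845) ∷ (14456 , 29403) ∷ (26252 , 30625) ∷
  (39188 , 43659) ∷ (45803 , 59535) ∷ (142382 , 218295) ∷ (265421 , 480249) ∷ (238988 , 617463) ∷
  (717887 , 1091475) ∷ (2348502 , 3705625) ∷ (5737349 , 7203735) ∷ (3407252 , 11116875) ∷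
  (221762 , 12006225) ∷ (11500337 , 36018675) ∷ (96635387 , 108056025) ∷ []

U₇ : Cs
U₇ =
  (3 , 5) ∷ (17 , 25) ∷ (5 , 27) ∷ (2 , 125) ∷ (14 , 135) ∷ (137 , 175) ∷ (266 , 297) ∷ (802 , 875) ∷
  (296 , 1029) ∷ (1157 , 1323) ∷ (727 , 1375) ∷ (779 , 1485) ∷ (1334 , 1701) ∷ (2179 , 2695) ∷
  (1262 , 3675) ∷ (3467 , 3969) ∷ (3614 , 6615) ∷ (914 , 10395) ∷ (10880 , 11319) ∷ (10082 , 11907) ∷
  (26849 , 40095) ∷ (48302 , 55125) ∷ (11552 , 165375) ∷ (195302 , 202125) ∷ (33167 , 205821) ∷
  (19427 , 259875) ∷ (470927 , 496125) ∷ (562802 , 606375) ∷ (358052 , 952875) ∷ (1720427 , 1819125) ∷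
  (11552 , 6670125) ∷ (8676677 , 16372125) ∷ []

U₈ : Cs
U₈ =
  (5 , 9) ∷ (65 , 81) ∷ (116 , 189) ∷ (263 , 567) ∷ (53 , 945) ∷ (37 , 1225) ∷ (1802 , 2025) ∷
  (233 , 2205) ∷ (1208 , 2835) ∷ (296 , 3087) ∷ (1187 , 4725) ∷ (4979 , 5103) ∷ (4877 , 5625) ∷
  (2792 , 6075) ∷ (7802 , 7875) ∷ (2792 , 8019) ∷ (8138 , 8505) ∷ (7499 , 9261) ∷ (5177 , 10125) ∷
  (4202 , 11025) ∷ (8012 , 14175) ∷ (8138 , 18711) ∷ (11387 , 22275) ∷ (7877 , 23625) ∷ (9677 , 30375) ∷
  (33896 , 35721) ∷ (9377 , 39375) ∷ (20612 , 42525) ∷ (34877 , 50625) ∷ (61877 , 70875) ∷ (62570 , 88209) ∷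
  (86627 , 91125) ∷ (18002 , 118125) ∷ (46127 , 151875) ∷ (91877 , 214375) ∷ (228377 , 297675) ∷
  (51752 , 354375) ∷ (299252 , 455625) ∷ (6437 , 467775) ∷ (247502 , 556875) ∷ (627302 , 637875) ∷
  (232427 , 1002375) ∷ (615638 , 1250235) ∷ (287102 , 1403325) ∷ (1393562 , 2083725) ∷ (3841877 , 3898125) ∷
  (1310213 , 4584195) ∷ (4764377 , 5011875) ∷ (2870177 , 5187875) ∷ (4866437 , 6251175) ∷
  (7227992 , 10085229) ∷ []

units₀ : Units
units₀ = U₀ ∷ U₁ ∷ U₂ ∷ U₃ ∷ U₄ ∷ U₅ ∷ U₆ ∷ U₇ ∷ U₈ ∷ []

D₀ : ℕ
D₀ = 18909804375

schedule₀ : List (ℕ × ℕ)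
schedule₀ =
  (3 , 3) ∷ (3 , 9) ∷ (3 , 27) ∷ (3 , 81) ∷ (3 , 243) ∷ (3 , 729) ∷
  (5 , 5) ∷ (5 , 25) ∷ (5 , 125) ∷ (5 , 625) ∷
  (7 , 7) ∷ (7 , 49) ∷ (7 , 343) ∷ (11 , 11) ∷ (11 , 121) ∷ []

base₀∣D₀ : All (λ c → modulus c ∣ D₀) base₀
base₀∣D₀ = from-yes (All.all? (λ c → modulus c ℕD.∣? D₀) base₀)

2∤D₀ : ¬ (2 ∣ D₀)
2∤D₀ = from-no (2 ℕD.∣? D₀)

system₀ : System
system₀ = record
  { D            = D₀
  ; base         = base₀
  ; units        = units₀
  ; covered      = everywhere schedule₀ base₀ units₀ tt
  ; base∣D       = base₀∣D₀
  ; units∣D      = from-yes (All.all? (All.all? (λ c → modulus c ℕD.∣? D₀)) units₀)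
  ; units-unique = from-yes (unique? ℕ._≟_ (concatMap (map modulus) units₀))
  ; 2∤D          = 2∤D₀
  ; 9∣D          = from-yes (9 ℕD.∣? D₀)
  ; admissible   = All.zipWith (λ (m∣D , bounds) → (λ 2∣m → 2∤D₀ (ℕD.∣-trans 2∣m m∣D)) , bounds)
                     (base₀∣D₀ , from-yes (All.all? (λ (r , m) → (1 ℕ.<? m) ×-dec (r ℕ.<? m)) base₀))
  ; unique       = from-yes (unique? (≡-dec ℕ._≟_ ℕ._≟_) base₀)
  ; unique-not9  = from-yes (unique? ℕ._≟_ (map modulus (withModulusNot9 base₀)))
  ; nines        = refl
  }

-- The extensions by the primes 13, 17, 19, 23 and 29

system₁ : System
-- Q = 13⁴ · 41 with 41 ≤ 9 · 5; the next two numbers are the inverses of Q modulo D and of D modulo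
-- Q. The following extensions use 17² · 31 with 31 ≤ 12 · 3, 19² · 43 with 43 ≤ 15 · 3, and 23 · 37
-- with 37 ≤ 20 · 2.
system₁ = Extension.extend system₀ 1171001
  13471552751
  336767
  refl (from-no (2 ℕD.∣? 1171001)) (chainSchedule 13 4 41) (chainKills 13 9 4 41) (chainUnits 13 9 4 3)
  tt tt tt tt (unique-slots (chainKills 13 9 4 41)) (unique-slots (concat (chainUnits 13 9 4 3)))

system₂ : System
system₂ = Extension.extend system₁ 8959
  32131286731564
  8946
  refl (from-no (2 ℕD.∣? 8959)) (chainSchedule 17 2 31) (chainKills 17 12 2 31) (chainUnits 17 12 2 3)
  tt tt tt tt (unique-slots (chainKills 17 12 2 31)) (unique-slots (concat (chainUnits 17 12 2 3)))

system₃ : System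
system₃ = Extension.extend system₂ 15523
  101242536928149420337
  7601
  refl (from-no (2 ℕD.∣? 15523)) (chainSchedule 19 2 43) (chainKills 19 15 2 43) (chainUnits 19 15 2 5)
  tt tt tt tt (unique-slots (chainKills 19 15 2 43)) (unique-slots (concat (chainUnits 19 15 2 5)))

system₄ : System
system₄ = Extension.extend system₃ 851
  2714008474123849990815401
  101
  refl (from-no (2 ℕD.∣? 851)) (chainSchedule 23 1 37) (chainKills 23 20 1 37) (chainUnits 23 20 1 10)
  tt tt tt tt (unique-slots (chainKills 23 20 1 37)) (unique-slots (concat (chainUnits 23 20 1 10)))

-- Each class modulo 29 gets its own unit among the 30 of `system₄`, so the slots differ although q
-- is always 29.
classes₂₉ : List Entry
classes₂₉ = map (λ h → h , (h , 29)) (upTo 29)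

-- No integer satisfies the family [] ∷ [] of units, so that the base of this system covers everything.
system₅ : System
system₅ = Extension.extend system₄ 29
  1988079463049069347970900819
  7
  refl (from-no (2 ℕD.∣? 29)) ((29 , 29) ∷ []) classes₂₉ ([] ∷ [])
  tt tt tt tt (unique-slots classes₂₉) []

theorem2p5 : ∃[ cs ] Theorem2p5Property cs
theorem2p5 = conclude system₅ refl
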